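{- There is a constant $0<c<1$ such that the following holds. Let $T=(V,E)$ be an unweighted tree with $n\ge3$ vertices, and let $v\in V$ minimize $IGL(T-v)$ over all vertices of $T$. Let $C$ be a connected component of $T-v$ containing $l$ vertices, and let $r=n-l-1$ be the number of vertices of $T-v$ not in $C$. Then $r\ge c\,n^{1/4}$.
   Context: For a graph $G=(V,E)$, $d_G(u,v)$ is the number of edges of a shortest $u$–$v$ path, or $\infty$ if none exists, with $1/\infty=0$; $IGL(G)=\sum_{\{u,v\}\subseteq V}\frac1{d_G(u,v)}$ over unordered pairs of distinct vertices. -}

module Defs where

open import Data.Bool using (Bool; true; false; _∧_; _∨_; if_then_else_)
open import Data.Nat as ℕ using (ℕ; zero; suc)
open import Data.Fin using (Fin; punchIn; _≟_; _<?_)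
open import Data.List using (List; []; _∷_; _++_; length; map; foldr)
open import Data.List.Relation.Unary.Unique.Propositional using (Unique)
open import Data.List.Relation.Unary.Linked using (Linked)
open import Data.Maybe using (Maybe; just; nothing)
open import Data.Product using (Σ; _×_; ∃)
open import Data.Integer using (+_)
open import Data.Rational using (ℚ; 0ℚ; _+_; _/_; _*_)
open import Data.Vec.Functional using (Vector)
open import Data.List using (allFin) renaming (sum to sumℕ)
open import Relation.Binary.PropositionalEquality using (_≡_; refl)
open import Relation.Nullary using (¬_; does)

record Graph (n : ℕ) : Set where
  field
    adj    : Fin n → Fin n → Bool
    sym    : ∀ i j → adj i j ≡ adj j i
    irrefl : ∀ i → adj i i ≡ false
open Graph public

Adj : ∀ {n} → Graph n → Fin n → Fin n → Set
Adj G i j = adj G i j ≡ true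

anyV : ∀ {n} → (Fin n → Bool) → Bool
anyV {n} f = foldr (λ i b → f i ∨ b) false (allFin n)

walkB : ∀ {n} → Graph n → ℕ → Fin n → Fin n → Bool
walkB G zero    u w = does (u ≟ w)
walkB G (suc k) u w = anyV (λ x → adj G u x ∧ walkB G k x w)

Reachable : ∀ {n} → Graph n → Fin n → Fin n → Set
Reachable G u w = ∃ λ k → walkB G k u w ≡ true

Connected : ∀ {n} → Graph n → Set
Connected G = ∀ u w → Reachable G u w

IsCycle : ∀ {n} → Graph n → Fin n → List (Fin n) → Set
IsCycle G x ys =
  (2 ℕ.≤ length ys) × Unique (x ∷ ys) × Linked (Adj G) (x ∷ ys ++ x ∷ [])

Acyclic : ∀ {n} → Graph n → Set
Acyclic G = ∀ x ys → ¬ IsCycle G x ys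

IsTree : ∀ {n} → Graph n → Set
IsTree G = Connected G × Acyclic G

-- Distance: length of a shortest walk (= shortest path); nothing encodes ∞.
-- A shortest path has at most n-1 edges, so checking k = 0 … n-1 suffices.
dist : ∀ {n} → Graph n → Fin n → Fin n → Maybe ℕ
dist {n} G u w = go 0 n
  where
  go : ℕ → ℕ → Maybe ℕ
  go k zero     = nothing
  go k (suc f)  = if walkB G k u w then just k else go (suc k) f

-- 1/d with 1/∞ = 0 (d = 0 only arises for u = w, which is never summed)
invD : Maybe ℕ → ℚ
invD nothing        = 0ℚ
invD (just zero)    = 0ℚ
invD (just (suc k)) = + 1 / suc k

sumℚ : List ℚ → ℚ
sumℚ = foldr _+_ 0ℚ

IGL : ∀ {n} → Graph n → ℚ
IGL {n} G = sumℚ (map (λ u → sumℚ (map (λ w →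
  if does (u <? w) then invD (dist G u w) else 0ℚ) (allFin n))) (allFin n))

_-ᵛ_ : ∀ {n} → Graph (suc n) → Fin (suc n) → Graph n
G -ᵛ v = record
  { adj    = λ i j → adj G (punchIn v i) (punchIn v j)
  ; sym    = λ i j → sym G (punchIn v i) (punchIn v j)
  ; irrefl = λ i → irrefl G (punchIn v i)
  }

ℕtoℚ : ℕ → ℚ
ℕtoℚ k = + k / 1

pow4 : ℚ → ℚ
pow4 q = q * q * q * q

{-# OPTIONS --safe #-}
module Submission where

-- Work with sums over ordered pairs of vertices, with 1/d_{T−w}(a,b) read as 0 if a = w or b = w.
-- Deleting w from a tree leaves the contribution 1/d(a,b) of a pair unchanged or, when w lies
-- on the path from a to b, destroys it. That path has d(a,b) + 1 vertices, so summing over all w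
-- the pair loses (d(a,b) + 1)/d(a,b) > 1; hence some vertex, and therefore the minimizer v, loses
-- at least n − 1. On the other hand, let u be the neighbour of v in C and K = r + 1. No path
-- between C and its complement survives in T − v or T − u, so comparing the two gives
-- S = Σ_{b ∈ C} 1/d(u,b) ≤ K² − K, and every path from outside C into C runs through u, so that
-- v loses at most K² − K + 2K(S + 1). Thus n = O(r³).

open import Defs hiding (sym)
open import Data.Nat using (ℕ; zero; suc; _∸_; z≤n; s≤s)
import Data.Nat as ℕ
open import Data.Fin using (Fin; punchIn; punchOut; _≟_)
open import Data.Fin.Subset using (Subset; _∈_; ∣_∣)
open import Data.Rational using (ℚ; 0ℚ; 1ℚ; _<_; _≤_; _+_; _*_)
open import Data.Product using (Σ; _×_; _,_; ∃; proj₁; proj₂)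
open import Function.Bundles using (_⇔_; Equivalence)

open import Algebra.Bundles using (CommutativeRing)
open import Data.Bool using (Bool; true; false; not; _∧_; _∨_; if_then_else_)
open import Data.Bool.Properties using (∨-zeroʳ)
import Data.Fin as Fin
import Data.Fin.Properties as Fin
open import Data.Fin.Properties
  using (punchInᵢ≢i; punchIn-punchOut; punchOut-cong; punchOut-punchIn)
open import Data.Fin.Subset.Properties using (∣p∣≤n)
import Data.Integer as ℤ
import Data.Integer.Properties as ℤ
open import Data.List as List using (List; []; _∷_; _++_; length; foldr; allFin)
open import Data.List.Membership.DecPropositional using (_∈?_)
open import Data.List.Membership.Propositional using () renaming (_∈_ to _∈ˡ_; _∉_ to _∉ˡ_)
open import Data.List.Membership.Propositional.Properties using (∈-allFin)
open import Data.List.Relation.Unary.All using (All; []; _∷_)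
open import Data.List.Relation.Unary.All.Properties using (¬Any⇒All¬; All¬⇒¬Any)
open import Data.List.Relation.Unary.AllPairs using ([]; _∷_)
open import Data.List.Relation.Unary.Any using (here; there)
open import Data.List.Relation.Unary.Linked using (Linked; [-]; _∷_)
open import Data.List.Relation.Unary.Unique.Propositional using (Unique)
open import Data.Maybe using (Maybe; just; nothing)
import Data.Nat.Properties as ℕ
open import Data.Nat.Solver using () renaming (module +-*-Solver to ℕ-Solver)
import Data.Rational as ℚ
import Data.Rational.Properties as ℚ
open import Data.Rational.Solver using (module +-*-Solver)
import Data.Rational.Unnormalised as ℚᵘ
import Data.Rational.Unnormalised.Properties as ℚᵘ
open import Data.Sum using (_⊎_; inj₁; inj₂)
open import Data.Unit using (⊤; tt)
open import Data.Vec as Vec using ([]; _∷_)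
open import Data.Vec.Functional using (insertAt)
open import Data.Vec.Functional.Properties using (insertAt-lookup; insertAt-punchIn)
open import Data.Vec.Properties using (lookup⇒[]=; []=⇒lookup)
open import Function using (_∘_; id)
open import Relation.Binary.PropositionalEquality
  using (_≡_; _≢_; refl; sym; trans; cong; cong₂; subst; subst₂; ≢-sym; module ≡-Reasoning)
open import Relation.Nullary using (¬_; does; proof; yes; no; contradiction)
open import Relation.Nullary.Decidable using (from-yes)
open import Relation.Nullary.Reflects using (Reflects; ofʸ; ofⁿ)

open import Algebra.Properties.Semiring.Sum (CommutativeRing.semiring ℚ.+-*-commutativeRing)
  using (sum; sum-cong-≗; sum-remove; ∑-distrib-+; ∑-comm; *-distribˡ-sum; *-distribʳ-sum)
open +-*-Solver using (solve; _:+_; _:*_; _:=_; con)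

private variable
  n k l : ℕ

false≢true : false ≢ true
false≢true ()

-- Walks and paths

-- `P` is required at every vertex, both ends included. With `P = (w ≢_)` this is a walk in the
-- graph without `w` that keeps the vertex numbering of `G`.
data Walk (G : Graph n) (P : Fin n → Set) : ℕ → Fin n → Fin n → Set where
  stop : ∀ {x} → P x → Walk G P 0 x x
  step : ∀ {x y z} → P x → Adj G x y → Walk G P k y z → Walk G P (suc k) x z

Adj-sym : (G : Graph n) → ∀ {x y} → Adj G x y → Adj G y x
Adj-sym G {x} {y} e = trans (Graph.sym G y x) e

module _ {G : Graph n} {P : Fin n → Set} where

  first : ∀ {x y} → Walk G P k x y → P x
  first (stop p)     = p
  first (step p _ _) = p

  last : ∀ {x y} → Walk G P k x y → P y
  last (stop p)     = p
  last (step _ _ w) = last w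

  snoc : ∀ {x y z} → Walk G P k x y → Adj G y z → P z → Walk G P (suc k) x z
  snoc (stop p)     e q = step p e (stop q)
  snoc (step p d w) e q = step p d (snoc w e q)

  reverse : ∀ {x y} → Walk G P k x y → Walk G P k y x
  reverse (stop p)     = stop p
  reverse (step p e w) = snoc (reverse w) (Adj-sym G e) p

  append : ∀ {x y z} → Walk G P k x y → Walk G P l y z → Walk G P (k ℕ.+ l) x z
  append (stop _)     w′ = w′
  append (step p e w) w′ = step p e (append w w′)

  mapWalk : ∀ {Q : Fin n → Set} {x y} → (∀ {z} → P z → Q z) → Walk G P k x y → Walk G Q k x y
  mapWalk f (stop p)     = stop (f p)
  mapWalk f (step p e w) = step (f p) e (mapWalk f w)

Any-or-true : (f : Fin n → Bool) (xs : List (Fin n)) →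
  foldr (λ i b → f i ∨ b) false xs ≡ true → ∃ λ x → f x ≡ true
Any-or-true f (x ∷ xs) eq with f x in fx
... | true  = x , fx
... | false = Any-or-true f xs eq

true-or-Any : (f : Fin n → Bool) {xs : List (Fin n)} {x : Fin n} →
  x ∈ˡ xs → f x ≡ true → foldr (λ i b → f i ∨ b) false xs ≡ true
true-or-Any f (here refl) eq rewrite eq = refl
true-or-Any f (there {x = y} i) eq rewrite true-or-Any f i eq = ∨-zeroʳ (f y)

walkB⇒Walk : (G : Graph n) → ∀ k u w → walkB G k u w ≡ true → Walk G (λ _ → ⊤) k u w
walkB⇒Walk G zero u w eq with u ≟ w
... | yes refl = stop tt
walkB⇒Walk {n} G (suc k) u w eq
  with Any-or-true (λ x → adj G u x ∧ walkB G k x w) (allFin n) eq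
... | x , ex with adj G u x in e
... | true = step tt e (walkB⇒Walk G k x w ex)

Walk⇒walkB : {G : Graph n} → ∀ {k u w} → Walk G (λ _ → ⊤) k u w → walkB G k u w ≡ true
Walk⇒walkB {u = u} (stop _) with u ≟ u
... | yes _  = refl
... | no u≢u = contradiction refl u≢u
Walk⇒walkB {G = G} {w = w} (step {k = k} {x = u} {y = y} _ e v) =
  true-or-Any (λ x → adj G u x ∧ walkB G k x w) (∈-allFin y) eq
  where
  eq : adj G u y ∧ walkB G k y w ≡ true
  eq rewrite e = Walk⇒walkB v

lift : (G : Graph (suc n)) (v : Fin (suc n)) → ∀ {k i j} →
  Walk (G -ᵛ v) (λ _ → ⊤) k i j → Walk G (v ≢_) k (punchIn v i) (punchIn v j)
lift G v (stop _)     = stop (≢-sym (punchInᵢ≢i v _))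
lift G v (step _ e w) = step (≢-sym (punchInᵢ≢i v _)) e (lift G v w)

lower : (G : Graph (suc n)) (v : Fin (suc n)) → ∀ {k x y} (p : v ≢ x) (q : v ≢ y) →
  Walk G (v ≢_) k x y → Walk (G -ᵛ v) (λ _ → ⊤) k (punchOut p) (punchOut q)
-- `p` and `q` may be different proofs of the same inequality, so the two ends agree only up to
-- `punchOut-cong`.
lower G v p q (stop _) = subst (Walk (G -ᵛ v) _ 0 _) (punchOut-cong v {i≢j = p} {i≢k = q} refl) (stop tt)
lower G v p q (step _ e w) =
  step tt (subst₂ (Adj G) (sym (punchIn-punchOut p)) (sym (punchIn-punchOut (first w))) e)
    (lower G v (first w) q w)

-- The last index lists the vertices visited, so that lying on the path is list membership and a
-- path with `k` edges has a list of length `suc k`.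
data Path (G : Graph n) : Fin n → Fin n → List (Fin n) → Set where
  nil  : ∀ {x} → Path G x x (x ∷ [])
  cons : ∀ {x y z vs} → Adj G x y → x ∉ˡ vs → Path G y z vs → Path G x z (x ∷ vs)

module _ {G : Graph n} where

  head∈ : ∀ {x y vs} → Path G x y vs → x ∈ˡ vs
  head∈ nil          = here refl
  head∈ (cons _ _ _) = here refl

  2≤length : ∀ {x y vs} → Path G x y vs → x ≢ y → 2 ℕ.≤ length vs
  2≤length nil x≢x                   = contradiction refl x≢x
  2≤length (cons _ _ nil) _          = s≤s (s≤s z≤n)
  2≤length (cons _ _ (cons _ _ _)) _ = s≤s (s≤s z≤n)

  Path⇒Unique : ∀ {x y vs} → Path G x y vs → Unique vs
  Path⇒Unique nil           = [] ∷ []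
  Path⇒Unique (cons _ x∉ p) = ¬Any⇒All¬ _ x∉ ∷ Path⇒Unique p

  Path⇒Linked : ∀ {x y z vs} → Path G x y vs → Adj G y z → Linked (Adj G) (vs ++ z ∷ [])
  Path⇒Linked nil e                       = e ∷ [-]
  Path⇒Linked (cons d _ nil) e            = d ∷ e ∷ [-]
  Path⇒Linked (cons d _ p@(cons _ _ _)) e = d ∷ Path⇒Linked p e

  Path⇒Walk : ∀ {P : Fin n → Set} {x y vs} → Path G x y vs → All P vs →
    ∃ λ k → length vs ≡ suc k × Walk G P k x y
  Path⇒Walk nil (p ∷ []) = 0 , refl , stop p
  Path⇒Walk (cons e _ q) (p ∷ ps) with Path⇒Walk q ps
  ... | k , eq , w = suc k , cong suc eq , step p e w

  suffix : ∀ {P : Fin n → Set} {x y z vs} → Path G y z vs → All P vs → x ∈ˡ vs →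
    ∃ λ us → Path G x z us × All P us × length us ℕ.≤ length vs
  suffix nil ps (here refl) = _ , nil , ps , ℕ.≤-refl
  suffix p@(cons _ _ _) ps (here refl) = _ , p , ps , ℕ.≤-refl
  suffix (cons _ _ p) (_ ∷ ps) (there i) with suffix p ps i
  ... | us , q , qs , le = us , q , qs , ℕ.m≤n⇒m≤1+n le

  -- If the new starting vertex already lies on the erased tail, the tail is cut down to its suffix
  -- from that vertex. This keeps `P` and does not lengthen the list.
  loopErase : ∀ {P : Fin n → Set} {x y} → Walk G P k x y →
    ∃ λ vs → Path G x y vs × All P vs × length vs ℕ.≤ suc k
  loopErase (stop p) = _ , nil , p ∷ [] , ℕ.≤-refl
  loopErase {x = x} (step p e w) with loopErase w
  ... | vs , q , qs , le with _∈?_ _≟_ x vs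
  ... | no x∉  = x ∷ vs , cons e x∉ q , p ∷ qs , s≤s le
  ... | yes x∈ with suffix q qs x∈
  ... | us , q′ , qs′ , le′ = us , q′ , qs′ , ℕ.m≤n⇒m≤1+n (ℕ.≤-trans le′ le)

-- Vertex-deleted trees

-- Connectedness after deletion of `w`, stated for vertices of `G`. It fails whenever `x` or `y` is
-- `w`.
Conn : Graph n → Fin n → Fin n → Fin n → Set
Conn G w x y = ∃ λ k → Walk G (w ≢_) k x y

module _ (G : Graph n) where

  Conn-trans : ∀ {w x y z} → Conn G w x y → Conn G w y z → Conn G w x z
  Conn-trans (_ , p) (_ , q) = _ , append p q

  Conn-sym : ∀ {w x y} → Conn G w x y → Conn G w y x
  Conn-sym (_ , p) = _ , reverse p

  Conn-Adj : ∀ {w x y} → w ≢ x → w ≢ y → Adj G x y → Conn G w x y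
  Conn-Adj p q e = _ , step p e (stop q)

  module _ (acyclic : Acyclic G) where

    -- A path from `a` to `b` that avoids `w` closes up through `w` to a cycle.
    ¬Conn-neighbours : ∀ {w a b} → Adj G w a → Adj G w b → a ≢ b → ¬ Conn G w a b
    ¬Conn-neighbours {w} ea eb a≢b (_ , p) with loopErase p
    ... | vs , q , ps , _ =
      acyclic w vs (2≤length q a≢b , (ps ∷ Path⇒Unique q) , linked q)
      where
      linked : ∀ {us} → Path G _ _ us → Linked (Adj G) (w ∷ us ++ w ∷ [])
      linked p@nil          = ea ∷ Path⇒Linked p (Adj-sym G eb)
      linked p@(cons _ _ _) = ea ∷ Path⇒Linked p (Adj-sym G eb)

    -- Every vertex of a path in an acyclic graph separates its ends. Induction moves along the path
    -- until `w` is the second vertex. Then its predecessor and successor on the path are distinct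
    -- neighbours of `w`, and an avoiding walk between the ends would join them in the graph without
    -- `w`.
    ∈Path⇒¬Conn : ∀ {w x y vs} → Path G x y vs → w ∈ˡ vs → ¬ Conn G w x y
    ∈Path⇒¬Conn p (here refl) c@(_ , q) with p
    ... | nil        = first q refl
    ... | cons _ _ _ = first q refl
    ∈Path⇒¬Conn {w} (cons {x = x} {y = z} e x∉ p) (there i) c@(_ , q) with w ≟ z
    ... | no w≢z = ∈Path⇒¬Conn p i (Conn-trans (Conn-sym (Conn-Adj (first q) w≢z e)) c)
    ∈Path⇒¬Conn {w} (cons e x∉ nil) (there i) (_ , q) | yes refl = last q refl
    ∈Path⇒¬Conn {w} (cons {x = x} e x∉ (cons {y = b} d w∉ p)) (there i) c@(_ , q) | yes refl =
      ¬Conn-neighbours (Adj-sym G e) d x≢b (Conn-trans c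
          (Conn-sym (_ , proj₂ (proj₂ (Path⇒Walk p (¬Any⇒All¬ _ w∉))))))
      where
      x≢b : x ≢ b
      x≢b refl = x∉ (there (head∈ p))

    -- The loop erasure of the given walk cannot meet `w`, since otherwise `w` would separate the
    -- ends. Hence deletion of `w` does not lengthen the distance of a pair that stays connected.
    avoid : ∀ {P : Fin n → Set} {w x y} → Walk G P k x y → Conn G w x y →
      ∃ λ j → j ℕ.≤ k × Walk G (w ≢_) j x y
    avoid {w = w} p c with loopErase p
    ... | vs , q , _ , le with _∈?_ _≟_ w vs
    ... | yes w∈ = contradiction c (∈Path⇒¬Conn q w∈)
    ... | no w∉ with Path⇒Walk q (¬Any⇒All¬ _ w∉)
    ... | j , eq , r = j , ℕ.s≤s⁻¹ (subst (ℕ._≤ _) eq le) , r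

  -- The edge `p q` is the first entry of the walk into `C`. It is used up, so the rest is strictly
  -- shorter.
  crossing : ∀ {P C : Fin n → Set} → (∀ z → C z ⊎ ¬ C z) → ∀ {x y} → Walk G P k x y → ¬ C x → C y →
    ∃ λ p → ∃ λ q → ∃ λ j → ¬ C p × C q × Adj G p q × j ℕ.< k × Walk G P j q y
  crossing C? (stop _) x∉ y∈ = contradiction y∈ x∉
  crossing C? (step {y = z} _ e w) x∉ y∈ with C? z
  ... | inj₁ z∈ = _ , z , _ , x∉ , z∈ , e , ℕ.≤-refl , w
  ... | inj₂ z∉ with crossing C? w z∉ y∈
  ... | p , q , j , p∉ , q∈ , d , lt , w′ = p , q , j , p∉ , q∈ , d , ℕ.m<n⇒m<1+n lt , w′

-- Rational arithmetic

-- `ℚ._/_` reduces fractions to lowest terms. In unnormalised rationals, comparisons become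
-- cross-multiplication of integers.
toℚᵘ-/ : ∀ k d → ℚ.toℚᵘ (ℤ.+ k ℚ./ suc d) ℚᵘ.≃ ℚᵘ.mkℚᵘ (ℤ.+ k) d
toℚᵘ-/ k d = ℚ.toℚᵘ-fromℚᵘ (ℚᵘ.mkℚᵘ (ℤ.+ k) d)

/-mono-≤ : ∀ a b c d → a ℕ.* suc d ℕ.≤ b ℕ.* suc c → ℤ.+ a ℚ./ suc c ≤ ℤ.+ b ℚ./ suc d
/-mono-≤ a b c d le = ℚ.toℚᵘ-cancel-≤
  (ℚᵘ.≤-respˡ-≃ (ℚᵘ.≃-sym (toℚᵘ-/ a c)) (ℚᵘ.≤-respʳ-≃ (ℚᵘ.≃-sym (toℚᵘ-/ b d))
    (ℚᵘ.*≤* (subst₂ ℤ._≤_ (ℤ.pos-* a (suc d)) (ℤ.pos-* b (suc c)) (ℤ.+≤+ le)))))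

ℕtoℚ-mono-≤ : k ℕ.≤ l → ℕtoℚ k ≤ ℕtoℚ l
ℕtoℚ-mono-≤ {k} {l} le = /-mono-≤ k l 0 0 (ℕ.*-monoˡ-≤ 1 le)

ℕtoℚ-cancel-≤ : ℕtoℚ k ≤ ℕtoℚ l → k ℕ.≤ l
ℕtoℚ-cancel-≤ {k} {l} le with ℚᵘ.≤-respˡ-≃ (toℚᵘ-/ k 0)
    (ℚᵘ.≤-respʳ-≃ (toℚᵘ-/ l 0) (ℚ.toℚᵘ-mono-≤ le))
... | ℚᵘ.*≤* q = ℤ.drop‿+≤+ (subst₂ ℤ._≤_ (ℤ.*-identityʳ (ℤ.+ k)) (ℤ.*-identityʳ (ℤ.+ l)) q)

ℕtoℚ-+ : ∀ k l → ℕtoℚ (k ℕ.+ l) ≡ ℕtoℚ k + ℕtoℚ l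
ℕtoℚ-+ k l = ℚ.toℚᵘ-injective (begin
  ℚ.toℚᵘ (ℕtoℚ (k ℕ.+ l))                       ≈⟨ toℚᵘ-/ (k ℕ.+ l) 0 ⟩
  ℚᵘ.mkℚᵘ (ℤ.+ (k ℕ.+ l)) 0
    ≈⟨ ℚᵘ.*≡* (cong (ℤ._* ℤ.1ℤ) (cong₂ ℤ._+_ (sym (ℤ.*-identityʳ (ℤ.+ k)))
        (sym (ℤ.*-identityʳ (ℤ.+ l))))) ⟩
  ℚᵘ.mkℚᵘ (ℤ.+ k) 0 ℚᵘ.+ ℚᵘ.mkℚᵘ (ℤ.+ l) 0      ≈⟨ ℚᵘ.+-cong (toℚᵘ-/ k 0) (toℚᵘ-/ l 0) ⟨
  ℚ.toℚᵘ (ℕtoℚ k) ℚᵘ.+ ℚ.toℚᵘ (ℕtoℚ l)          ≈⟨ ℚ.toℚᵘ-homo-+ (ℕtoℚ k) (ℕtoℚ l) ⟨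
  ℚ.toℚᵘ (ℕtoℚ k + ℕtoℚ l)                      ∎)
  where
  open ℚᵘ.≃-Reasoning

ℕtoℚ-* : ∀ k l → ℕtoℚ (k ℕ.* l) ≡ ℕtoℚ k * ℕtoℚ l
ℕtoℚ-* k l = ℚ.toℚᵘ-injective (begin
  ℚ.toℚᵘ (ℕtoℚ (k ℕ.* l))                       ≈⟨ toℚᵘ-/ (k ℕ.* l) 0 ⟩
  ℚᵘ.mkℚᵘ (ℤ.+ (k ℕ.* l)) 0                     ≈⟨ ℚᵘ.*≡* (cong (ℤ._* ℤ.1ℤ) (ℤ.pos-* k l)) ⟩
  ℚᵘ.mkℚᵘ (ℤ.+ k) 0 ℚᵘ.* ℚᵘ.mkℚᵘ (ℤ.+ l) 0      ≈⟨ ℚᵘ.*-cong (toℚᵘ-/ k 0) (toℚᵘ-/ l 0) ⟨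
  ℚ.toℚᵘ (ℕtoℚ k) ℚᵘ.* ℚ.toℚᵘ (ℕtoℚ l)          ≈⟨ ℚ.toℚᵘ-homo-* (ℕtoℚ k) (ℕtoℚ l) ⟨
  ℚ.toℚᵘ (ℕtoℚ k * ℕtoℚ l)                      ∎)
  where open ℚᵘ.≃-Reasoning

suc*invD : ∀ d → ℕtoℚ (suc d) * invD (just (suc d)) ≡ 1ℚ
suc*invD d = ℚ.toℚᵘ-injective (begin
  ℚ.toℚᵘ (ℕtoℚ (suc d) * invD (just (suc d)))                ≈⟨ ℚ.toℚᵘ-homo-* (ℕtoℚ (suc d)) _ ⟩
  ℚ.toℚᵘ (ℕtoℚ (suc d)) ℚᵘ.* ℚ.toℚᵘ (invD (just (suc d)))
    ≈⟨ ℚᵘ.*-cong (toℚᵘ-/ (suc d) 0) (toℚᵘ-/ 1 d) ⟩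
  ℚᵘ.mkℚᵘ (ℤ.+ suc d) 0 ℚᵘ.* ℚᵘ.mkℚᵘ (ℤ.+ 1) d
    ≈⟨ ℚᵘ.*≡* (cong ℤ.+_ (trans (ℕ.*-identityʳ (suc d ℕ.* 1))
        (trans (ℕ.*-comm (suc d) 1) (sym (ℕ.*-identityˡ (1 ℕ.* suc d)))))) ⟩
  ℚᵘ.1ℚᵘ                                                     ∎)
  where open ℚᵘ.≃-Reasoning

invD-nonneg : ∀ d → 0ℚ ≤ invD d
invD-nonneg nothing        = ℚ.≤-refl
invD-nonneg (just zero)    = ℚ.≤-refl
invD-nonneg (just (suc d)) = /-mono-≤ 0 1 0 d z≤n

invD-antitone : suc k ℕ.≤ suc l → invD (just (suc l)) ≤ invD (just (suc k))
invD-antitone {k} {l} le = /-mono-≤ 1 1 l k (ℕ.*-monoʳ-≤ 1 le)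

invD≤1 : ∀ d → invD d ≤ 1ℚ
invD≤1 nothing        = /-mono-≤ 0 1 0 0 z≤n
invD≤1 (just zero)    = /-mono-≤ 0 1 0 0 z≤n
invD≤1 (just (suc d)) = invD-antitone {0} {d} (s≤s z≤n)

-- Finite sums and indicator functions

sum-mono : {f g : Fin n → ℚ} → (∀ i → f i ≤ g i) → sum f ≤ sum g
sum-mono {zero}  le = ℚ.≤-refl
sum-mono {suc n} le = ℚ.+-mono-≤ (le Fin.zero) (sum-mono (le ∘ Fin.suc))

sum-const : ∀ n c → sum {n} (λ _ → c) ≡ ℕtoℚ n * c
sum-const zero    c = sym (ℚ.*-zeroˡ c)
sum-const (suc n) c = begin
  c + sum {n} (λ _ → c)  ≡⟨ cong (c +_) (sum-const n c) ⟩
  c + ℕtoℚ n * c         ≡⟨ cong (_+ ℕtoℚ n * c) (ℚ.*-identityˡ c) ⟨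
  1ℚ * c + ℕtoℚ n * c    ≡⟨ ℚ.*-distribʳ-+ c 1ℚ (ℕtoℚ n) ⟨
  (1ℚ + ℕtoℚ n) * c      ≡⟨ cong (_* c) (ℕtoℚ-+ 1 n) ⟨
  ℕtoℚ (suc n) * c       ∎
  where open ≡-Reasoning

sum-zero : {f : Fin n → ℚ} → (∀ i → f i ≡ 0ℚ) → sum f ≡ 0ℚ
sum-zero {n} eq = trans (sum-cong-≗ eq) (trans (sum-const n 0ℚ) (ℚ.*-zeroʳ (ℕtoℚ n)))

sumℚ-allFin : (f : Fin n → ℚ) → sumℚ (List.map f (allFin n)) ≡ sum f
sumℚ-allFin f = go f id
  where
  go : ∀ {n k} (f : Fin k → ℚ) (g : Fin n → Fin k) →
    sumℚ (List.map f (List.tabulate g)) ≡ sum (f ∘ g)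
  go {zero}  f g = refl
  go {suc n} f g = cong (f (g Fin.zero) +_) (go f (g ∘ Fin.suc))

χ : Bool → ℚ
χ b = if b then 1ℚ else 0ℚ

δ : Fin n → Fin n → ℚ
δ i j = χ (does (i ≟ j))

δ-refl : (i : Fin n) → δ i i ≡ 1ℚ
δ-refl i with i ≟ i
... | yes _  = refl
... | no i≢i = contradiction refl i≢i

δ-≢ : {i j : Fin n} → i ≢ j → δ i j ≡ 0ℚ
δ-≢ {i = i} {j} i≢j with i ≟ j
... | yes i≡j = contradiction i≡j i≢j
... | no _    = refl

sum-δ : (i : Fin n) (f : Fin n → ℚ) → sum (λ j → δ i j * f j) ≡ f i
sum-δ {suc n} i f = begin
  sum g                                  ≡⟨ sum-remove {i = i} g ⟩
  g i + sum (λ j → g (punchIn i j))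
    ≡⟨ cong (g i +_) (sum-zero λ j → trans (cong (_* f (punchIn i j))
        (δ-≢ (≢-sym (punchInᵢ≢i i j)))) (ℚ.*-zeroˡ (f (punchIn i j)))) ⟩
  δ i i * f i + 0ℚ                       ≡⟨ ℚ.+-identityʳ _ ⟩
  δ i i * f i                            ≡⟨ cong (_* f i) (δ-refl i) ⟩
  1ℚ * f i                               ≡⟨ ℚ.*-identityˡ _ ⟩
  f i                                    ∎
  where
  open ≡-Reasoning
  g = λ j → δ i j * f j

member : List (Fin n) → Fin n → ℚ
member vs w = χ (does (_∈?_ _≟_ w vs))

sum-member : {vs : List (Fin n)} → Unique vs → sum (member vs) ≡ ℕtoℚ (length vs)
sum-member {n} {[]} _ = sum-zero {n} λ _ → refl
sum-member {n} {v ∷ vs} (v∉ ∷ u) = begin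
  sum (member (v ∷ vs))                        ≡⟨ sum-cong-≗ pointwise ⟩
  sum (λ w → δ v w * 1ℚ + member vs w)         ≡⟨ ∑-distrib-+ (λ w → δ v w * 1ℚ) (member vs) ⟩
  sum (λ w → δ v w * 1ℚ) + sum (member vs)     ≡⟨ cong₂ _+_ (sum-δ v (λ _ → 1ℚ)) (sum-member u) ⟩
  1ℚ + ℕtoℚ (length vs)                        ≡⟨ ℕtoℚ-+ 1 (length vs) ⟨
  ℕtoℚ (suc (length vs))                       ∎
  where
  open ≡-Reasoning
  pointwise : ∀ w → member (v ∷ vs) w ≡ δ v w * 1ℚ + member vs w
  -- `δ` tests `v ≟ w` while list membership tests `w ≟ v`, so both are analysed. Uniqueness
  -- excludes double counting of `v`.
  pointwise w with v ≟ w | w ≟ v | _∈?_ _≟_ w vs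
  ... | yes refl | yes _   | yes w∈ = contradiction w∈ (All¬⇒¬Any v∉)
  ... | yes refl | yes _   | no _   = refl
  ... | yes v≡w  | no w≢v  | _      = contradiction (sym v≡w) w≢v
  ... | no v≢w   | yes w≡v | _      = contradiction (sym w≡v) v≢w
  ... | no _     | no _    | yes _  = refl
  ... | no _     | no _    | no _   = refl

member≤1 : (vs : List (Fin n)) → ∀ w → member vs w ≤ 1ℚ
member≤1 vs w with does (_∈?_ _≟_ w vs)
... | true  = ℚ.≤-refl
... | false = /-mono-≤ 0 1 0 0 z≤n

-- Pigeonhole by summation: the indicator of the list is at most 1 at each vertex and sums to the
-- length.
Unique⇒length≤ : {vs : List (Fin n)} → Unique vs → length vs ℕ.≤ n
Unique⇒length≤ {n} {vs} u = ℕtoℚ-cancel-≤ (subst₂ _≤_ (sum-member u)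
    (trans (sum-const n 1ℚ) (ℚ.*-identityʳ _)) (sum-mono (member≤1 vs)))

-- Distances

mutual
  -- dist's local loop is out of scope; it is recovered by unification, abstracting
  -- suc f and 1 so that the unification problem becomes a Miller pattern.
  distLoop : ∀ n → Graph n → Fin n → Fin n → ℕ → ℕ → Maybe ℕ
  distLoop = _

  dist-suc : ∀ f (G : Graph (suc f)) u w →
    dist G u w ≡ (if walkB G 0 u w then just 0 else distLoop (suc f) G u w 1 f)
  dist-suc f with suc f | 1
  ... | n | k = λ G u w → refl

AnyWalk : (G : Graph n) → ℕ → Fin n → Fin n → Set
AnyWalk G = Walk G (λ _ → ⊤)

-- The meaning of `dist` in terms of walks: `none` excludes walks of every length, not only those
-- that the bounded search tests.
data Distance (G : Graph n) (u w : Fin n) : Maybe ℕ → Set where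
  none : (∀ {k} → ¬ AnyWalk G k u w) → Distance G u w nothing
  some : ∀ {d} → AnyWalk G d u w → (∀ {k} → AnyWalk G k u w → d ℕ.≤ k) → Distance G u w (just d)

-- The search invariant says that no walk is shorter than `k`. When the fuel is exhausted, `k` is at
-- least `n`, while a loop-erased walk has at most `n` vertices and so fewer than `n` edges.
distLoop-Distance : (G : Graph n) (u w : Fin n) → ∀ k f →
  (∀ {j} → AnyWalk G j u w → k ℕ.≤ j) → n ℕ.≤ k ℕ.+ f → Distance G u w (distLoop n G u w k f)
distLoop-Distance G u w k zero min n≤k = none noWalk
  where
  noWalk : ∀ {j} → ¬ AnyWalk G j u w
  noWalk p with loopErase p
  ... | vs , q , ps , _ with Path⇒Walk q ps
  ... | j , eq , r = ℕ.<-irrefl refl (ℕ.≤-trans (ℕ.≤-reflexive (sym eq))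
        (ℕ.≤-trans (Unique⇒length≤ (Path⇒Unique q))
            (ℕ.≤-trans n≤k (ℕ.≤-trans (ℕ.≤-reflexive (ℕ.+-identityʳ k)) (min r)))))
distLoop-Distance {n} G u w k (suc f) min n≤ with walkB G k u w in eq
... | true  = some (walkB⇒Walk G k u w eq) min
... | false = distLoop-Distance G u w (suc k) f min′ (subst (n ℕ.≤_) (ℕ.+-suc k f) n≤)
  where
  min′ : ∀ {j} → AnyWalk G j u w → suc k ℕ.≤ j
  min′ {j} p = ℕ.≤∧≢⇒< (min p) λ { refl → false≢true (trans (sym eq) (Walk⇒walkB p)) }

distance : (G : Graph n) (u w : Fin n) → Distance G u w (dist G u w)
distance {n} G u w = distLoop-Distance G u w 0 n (λ _ → z≤n) ℕ.≤-refl

proximity : Graph n → Fin n → Fin n → ℚ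
proximity G u w = invD (dist G u w)

module _ (G : Graph n) where

  -- Because `invD` sends distance 0 to 0, sums over ordered pairs may include the diagonal.
  proximity-self : ∀ u → proximity G u u ≡ 0ℚ
  proximity-self u with dist G u u | distance G u u
  ... | _            | none _     = refl
  ... | just zero    | some _ _   = refl
  ... | just (suc d) | some _ min with min (stop tt)
  ... | ()

  proximity-sym : ∀ u w → proximity G u w ≡ proximity G w u
  proximity-sym u w with dist G u w | distance G u w | dist G w u | distance G w u
  ... | _ | none _      | _ | none _       = refl
  ... | _ | none ¬p     | _ | some q _     = contradiction (reverse q) ¬p
  ... | _ | some p _    | _ | none ¬q      = contradiction (reverse p) ¬q
  ... | _ | some p minp | _ | some q minq  =
    cong (invD ∘ just) (ℕ.≤-antisym (minp (reverse q)) (minq (reverse p)))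

  -- `shorten` makes `u` at least as close to `c` as `a` is. The case `u ≡ c` is excluded since
  -- distance 0 has value 0 instead of a large one.
  proximity-mono : ∀ {a u c} → u ≢ c →
    (∀ {k} → AnyWalk G k a c → ∃ λ j → j ℕ.≤ k × AnyWalk G j u c) →
    proximity G a c ≤ proximity G u c
  proximity-mono {a} {u} {c} u≢c shorten
    with dist G a c | distance G a c | dist G u c | distance G u c
  ... | _ | none _ | d | _ = invD-nonneg d
  ... | _ | some p _ | _ | none ¬q = contradiction (proj₂ (proj₂ (shorten p))) ¬q
  ... | _ | some p _ | _ | some (stop _) _ = contradiction refl u≢c
  ... | _ | some p _ | _ | some (step _ _ _) min with shorten p
  ... | j , j≤ , r with ℕ.≤-trans (min r) j≤
  ... | s≤s le = invD-antitone (s≤s le)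

-- Sums over ordered pairs before and after vertex deletion

-- The matrix of proximities is symmetric with zero diagonal, hence its strict upper triangle, which
-- `IGL` sums, plus the transpose of that triangle.
IGL-doubled : (G : Graph n) → sum (λ u → sum (proximity G u)) ≡ IGL G + IGL G
IGL-doubled {n} G = begin
  sum (λ u → sum (proximity G u))
    ≡⟨ sum-cong-≗ (λ u → trans (sum-cong-≗ (split u)) (∑-distrib-+ (up u) (λ w → up w u))) ⟩
  sum (λ u → sum (up u) + sum (λ w → up w u))
    ≡⟨ ∑-distrib-+ (λ u → sum (up u)) (λ u → sum (λ w → up w u)) ⟩
  sum (λ u → sum (up u)) + sum (λ u → sum (λ w → up w u))
    ≡⟨ cong (sum (λ u → sum (up u)) +_) (∑-comm (λ u w → up w u)) ⟩
  sum (λ u → sum (up u)) + sum (λ u → sum (up u))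
    ≡⟨ cong (λ z → z + z) IGL-sum ⟨
  IGL G + IGL G                                                              ∎
  where
  open ≡-Reasoning
  up : Fin n → Fin n → ℚ
  up u w = if does (u Fin.<? w) then proximity G u w else 0ℚ
  IGL-sum : IGL G ≡ sum (λ u → sum (up u))
  IGL-sum = trans (sumℚ-allFin (λ u → sumℚ (List.map (up u) (allFin n))))
      (sum-cong-≗ (λ u → sumℚ-allFin (up u)))
  split : ∀ u w → proximity G u w ≡ up u w + up w u
  split u w = compare _ _ (proof (u Fin.<? w)) (proof (w Fin.<? u))
    where
    compare : ∀ p q → Reflects (u Fin.< w) p → Reflects (w Fin.< u) q →
      proximity G u w ≡ (if p then proximity G u w else 0ℚ) + (if q then proximity G w u else 0ℚ)
    compare _ _ (ofʸ u<w) (ofʸ w<u) = contradiction w<u (ℕ.<-asym u<w)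
    compare _ _ (ofʸ u<w) (ofⁿ _)   = sym (ℚ.+-identityʳ _)
    compare _ _ (ofⁿ _)   (ofʸ w<u) = trans (proximity-sym G u w) (sym (ℚ.+-identityˡ _))
    compare _ _ (ofⁿ u≮w) (ofⁿ w≮u) with Fin.toℕ-injective (ℕ.≤-antisym (ℕ.≮⇒≥ w≮u) (ℕ.≮⇒≥ u≮w))
    ... | refl = proximity-self G u

-- Pairs containing w get 0, so that residuals for different w can be compared pointwise.
residual : Graph (suc n) → Fin (suc n) → Fin (suc n) → Fin (suc n) → ℚ
residual G w a b with w ≟ a | w ≟ b
... | no p | no q = proximity (G -ᵛ w) (punchOut p) (punchOut q)
... | _    | _    = 0ℚ

module _ (G : Graph (suc n)) where

  residual-selfˡ : ∀ w b → residual G w w b ≡ 0ℚ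
  residual-selfˡ w b with w ≟ w | w ≟ b
  ... | yes _  | _ = refl
  ... | no w≢w | _ = contradiction refl w≢w

  residual-selfʳ : ∀ w a → residual G w a w ≡ 0ℚ
  residual-selfʳ w a with w ≟ a | w ≟ w
  ... | yes _ | _      = refl
  ... | no _  | yes _  = refl
  ... | no _  | no w≢w = contradiction refl w≢w

  residual-punchIn : ∀ w i j → residual G w (punchIn w i) (punchIn w j) ≡ proximity (G -ᵛ w) i j
  residual-punchIn w i j with w ≟ punchIn w i | w ≟ punchIn w j
  ... | yes eq | _      = contradiction (sym eq) (punchInᵢ≢i w i)
  ... | no _   | yes eq = contradiction (sym eq) (punchInᵢ≢i w j)
  ... | no p   | no q   = cong₂ (proximity (G -ᵛ w)) (out i p) (out j q)
    where
    out : ∀ i (p : w ≢ punchIn w i) → punchOut p ≡ i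
    out i p = trans (punchOut-cong w refl) (punchOut-punchIn w)

  -- Row and column `w` of the residual vanish, and what remains is the proximity matrix of
  -- `G -ᵛ w`.
  sum-residual : ∀ w → sum (λ a → sum (residual G w a)) ≡ IGL (G -ᵛ w) + IGL (G -ᵛ w)
  sum-residual w = begin
    sum (λ a → sum (residual G w a))
      ≡⟨ drop (λ a → sum (residual G w a)) (sum-zero (residual-selfˡ w)) ⟩
    sum (λ i → sum (residual G w (punchIn w i)))
      ≡⟨ sum-cong-≗ (λ i → drop (residual G w (punchIn w i)) (residual-selfʳ w (punchIn w i))) ⟩
    sum (λ i → sum (λ j → residual G w (punchIn w i) (punchIn w j)))
      ≡⟨ sum-cong-≗ (λ i → sum-cong-≗ (residual-punchIn w i)) ⟩
    sum (λ i → sum (proximity (G -ᵛ w) i))                             ≡⟨ IGL-doubled (G -ᵛ w) ⟩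
    IGL (G -ᵛ w) + IGL (G -ᵛ w)                                        ∎
    where
    open ≡-Reasoning
    drop : (f : Fin (suc n) → ℚ) → f w ≡ 0ℚ → sum f ≡ sum (λ i → f (punchIn w i))
    drop f f0 = trans (sum-remove {i = w} f) (trans (cong (_+ sum (λ i → f (punchIn w i))) f0)
        (ℚ.+-identityˡ _))

  -- In an acyclic graph, deletion of `w` either disconnects the pair or preserves its distance: by
  -- `avoid`, a shortest walk can be replaced by one that misses `w` and is no longer.
  residual-dichotomy : Acyclic G → ∀ w a b →
    (Conn G w a b × residual G w a b ≡ proximity G a b) ⊎ (¬ Conn G w a b × residual G w a b ≡ 0ℚ)
  residual-dichotomy acyclic w a b with w ≟ a | w ≟ b
  ... | yes refl | _ = inj₂ ((λ (_ , p) → first p refl) , refl)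
  ... | no _ | yes refl = inj₂ ((λ (_ , p) → last p refl) , refl)
  ... | no p | no q
    with dist (G -ᵛ w) (punchOut p) (punchOut q) | distance (G -ᵛ w) (punchOut p) (punchOut q)
  ... | _ | none ¬r = inj₂ ((λ (_ , r) → ¬r (lower G w p q r)) , refl)
  ... | _ | some {d} r min = inj₁ ((d , r′) , eq)
    where
    r′ = subst₂ (Walk G (w ≢_) d) (punchIn-punchOut p) (punchIn-punchOut q) (lift G w r)
    eq : invD (just d) ≡ proximity G a b
    eq with dist G a b | distance G a b
    ... | _ | none ¬s = contradiction (mapWalk (λ _ → tt) r′) ¬s
    ... | _ | some s min′ with avoid G acyclic s (_ , r′)
    ... | j , j≤ , s′ = cong (invD ∘ just) (ℕ.≤-antisym (ℕ.≤-trans (min (lower G w p q s′)) j≤)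
        (min′ (mapWalk (λ _ → tt) r′)))

-- Cancellation and double sums

+-cancel-neg : ∀ p r → (p + r) + ℚ.- r ≡ p
+-cancel-neg p r =
  trans (ℚ.+-assoc p r (ℚ.- r)) (trans (cong (p +_) (ℚ.+-inverseʳ r)) (ℚ.+-identityʳ p))

+-cancelʳ-≤ : ∀ r {p q} → p + r ≤ q + r → p ≤ q
+-cancelʳ-≤ r {p} {q} le =
  subst₂ _≤_ (+-cancel-neg p r) (+-cancel-neg q r) (ℚ.+-monoˡ-≤ (ℚ.- r) le)

-- The equation says y − x = y′ − x′ without subtraction.
≤-shift : ∀ {x y x′ y′} → x′ ≤ y′ → x + y′ ≡ y + x′ → x ≤ y
≤-shift {x} {y} {x′} {y′} le eq =
  +-cancelʳ-≤ y′ (ℚ.≤-trans (ℚ.≤-reflexive eq) (ℚ.+-monoʳ-≤ y le))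

sum-δ-1 : (i : Fin n) → sum (δ i) ≡ 1ℚ
sum-δ-1 i = trans (sum-cong-≗ (λ j → sym (ℚ.*-identityʳ (δ i j)))) (sum-δ i (λ _ → 1ℚ))

δ-elim : (P : ℚ → Set) (i j : Fin n) → (i ≡ j → P 1ℚ) → (i ≢ j → P 0ℚ) → P (δ i j)
δ-elim P i j eq ne with i ≟ j
... | yes i≡j = eq i≡j
... | no i≢j  = ne i≢j

sum₂ : (Fin n → Fin n → ℚ) → ℚ
sum₂ f = sum (λ a → sum (f a))

sum₂-mono : {f g : Fin n → Fin n → ℚ} → (∀ a b → f a b ≤ g a b) → sum₂ f ≤ sum₂ g
sum₂-mono le = sum-mono (λ a → sum-mono (le a))

sum₂-+ : (f g : Fin n → Fin n → ℚ) → sum₂ (λ a b → f a b + g a b) ≡ sum₂ f + sum₂ g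
sum₂-+ f g = trans (sum-cong-≗ (λ a → ∑-distrib-+ (f a) (g a)))
    (∑-distrib-+ (λ a → sum (f a)) (λ a → sum (g a)))

sum₂-product : (p q : Fin n → ℚ) → sum₂ (λ a b → p a * q b) ≡ sum p * sum q
sum₂-product p q = trans (sum-cong-≗ (λ a → sym (*-distribˡ-sum (p a) q)))
    (sym (*-distribʳ-sum (sum q) p))

sum₂-productʳ : (p q : Fin n → ℚ) → sum₂ (λ a b → p b * q a) ≡ sum p * sum q
sum₂-productʳ p q = trans (∑-comm (λ a b → p b * q a)) (sum₂-product p q)

sum₂-δ : (p : Fin n → ℚ) → sum₂ (λ a b → δ a b * p a) ≡ sum p
sum₂-δ p = sum-cong-≗ (λ a → sum-δ a (λ _ → p a))

sum₂-scale : ∀ r (f : Fin n → Fin n → ℚ) → sum₂ (λ a b → r * f a b) ≡ r * sum₂ f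
sum₂-scale r f = trans (sum-cong-≗ (λ a → sym (*-distribˡ-sum r (f a))))
    (sym (*-distribˡ-sum r (λ a → sum (f a))))

sum₂-nonneg : {f : Fin n → Fin n → ℚ} → (∀ a b → 0ℚ ≤ f a b) → 0ℚ ≤ sum₂ f
sum₂-nonneg {n} {f} le = subst (_≤ sum₂ f) (sum-zero {n} (λ _ → sum-zero {n} (λ _ → refl)))
    (sum₂-mono {f = λ _ _ → 0ℚ} le)

-- The total loss over all vertex deletions

module _ {m : ℕ} (G : Graph (suc m)) (acyclic : Acyclic G) where

  private
    f = proximity G
    R = residual G

  residual-nonneg : ∀ w a b → 0ℚ ≤ R w a b
  residual-nonneg w a b with residual-dichotomy G acyclic w a b
  ... | inj₁ (_ , eq) = subst (0ℚ ≤_) (sym eq) (invD-nonneg (dist G a b))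
  ... | inj₂ (_ , eq) = ℚ.≤-reflexive (sym eq)

  residual≤proximity : ∀ w a b → R w a b ≤ f a b
  residual≤proximity w a b with residual-dichotomy G acyclic w a b
  ... | inj₁ (_ , eq) = ℚ.≤-reflexive eq
  ... | inj₂ (_ , eq) = subst (_≤ f a b) (sym eq) (invD-nonneg (dist G a b))

  Conn⇒residual : ∀ {w a b} → Conn G w a b → R w a b ≡ f a b
  Conn⇒residual {w} {a} {b} c with residual-dichotomy G acyclic w a b
  ... | inj₁ (_ , eq) = eq
  ... | inj₂ (¬c , _) = contradiction c ¬c

  ¬Conn⇒residual : ∀ {w a b} → ¬ Conn G w a b → R w a b ≡ 0ℚ
  ¬Conn⇒residual {w} {a} {b} ¬c with residual-dichotomy G acyclic w a b
  ... | inj₁ (c , _)  = contradiction c ¬c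
  ... | inj₂ (_ , eq) = eq

  residual-diag : ∀ w a → R w a a ≡ 0ℚ
  residual-diag w a = ℚ.≤-antisym
    (subst (R w a a ≤_) (proximity-self G a) (residual≤proximity w a a)) (residual-nonneg w a a)

  module _ (connected : ∀ a b → ∃ λ k → AnyWalk G k a b) where

    -- Each vertex on the path from `a` to `b` destroys the whole contribution 1/d. There are at
    -- least d + 1 of them, so the loss is at least (d + 1)/d = 1 + 1/d.
    sum-residual-pair : ∀ {a b} → a ≢ b → sum (λ w → R w a b) + (1ℚ + f a b) ≤ ℕtoℚ (suc m) * f a b
    sum-residual-pair {a} {b} a≢b with dist G a b in eq | distance G a b
    ... | _ | none ¬p = contradiction (proj₂ (connected a b)) ¬p
    ... | _ | some (stop _) _ = contradiction refl a≢b
    ... | _ | some {suc d} p@(step _ _ _) min with loopErase p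
    ... | vs , q , ps , _ with Path⇒Walk q ps
    ... | j , len , r = begin
        sum (λ w → R w a b) + (1ℚ + g)
          ≤⟨ ℚ.+-monoʳ-≤ (sum (λ w → R w a b)) enough ⟩
        sum (λ w → R w a b) + sum (member vs) * g
          ≡⟨ cong (sum (λ w → R w a b) +_) (*-distribʳ-sum g (member vs)) ⟩
        sum (λ w → R w a b) + sum (λ w → member vs w * g)
          ≡⟨ ∑-distrib-+ (λ w → R w a b) (λ w → member vs w * g) ⟨
        sum (λ w → R w a b + member vs w * g)                  ≤⟨ sum-mono pointwise ⟩
        sum {suc m} (λ _ → g)                                  ≡⟨ sum-const (suc m) g ⟩
        ℕtoℚ (suc m) * g                                       ∎
      where
      open ℚ.≤-Reasoning
      g = invD (just (suc d))
      instance
        g-nonneg : ℚ.NonNegative g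
        g-nonneg = ℚ.nonNegative (invD-nonneg (just (suc d)))
      f≡g : f a b ≡ g
      f≡g = cong invD eq
      enough : 1ℚ + g ≤ sum (member vs) * g
      enough = begin
        1ℚ + g                            ≡⟨ cong₂ _+_ (sym (suc*invD d)) (sym (ℚ.*-identityˡ g)) ⟩
        ℕtoℚ (suc d) * g + 1ℚ * g         ≡⟨ ℚ.*-distribʳ-+ g (ℕtoℚ (suc d)) 1ℚ ⟨
        (ℕtoℚ (suc d) + 1ℚ) * g           ≡⟨ cong (_* g) (ℕtoℚ-+ (suc d) 1) ⟨
        ℕtoℚ (suc d ℕ.+ 1) * g            ≤⟨ ℚ.*-monoʳ-≤-nonNeg g (ℕtoℚ-mono-≤ bound) ⟩
        ℕtoℚ (length vs) * g              ≡⟨ cong (_* g) (sum-member (Path⇒Unique q)) ⟨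
        sum (member vs) * g               ∎
        where
        bound : suc d ℕ.+ 1 ℕ.≤ length vs
        bound = subst₂ ℕ._≤_ (ℕ.+-comm 1 (suc d)) (sym len) (s≤s (min r))
      pointwise : ∀ w → R w a b + member vs w * g ≤ g
      pointwise w with _∈?_ _≟_ w vs
      ... | yes w∈ = ℚ.≤-reflexive (trans (cong₂ _+_ (¬Conn⇒residual (∈Path⇒¬Conn G acyclic q w∈))
          (ℚ.*-identityˡ g)) (ℚ.+-identityˡ g))
      ... | no _   = subst₂ _≤_ (sym (trans (cong (R w a b +_) (ℚ.*-zeroˡ g))
          (ℚ.+-identityʳ (R w a b)))) f≡g (residual≤proximity w a b)

    -- This sums `sum-residual-pair` over the N² - N ordered pairs off the diagonal, with N moved to
    -- the right to avoid subtraction.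
    sum-residuals : sum (λ w → sum₂ (R w)) + (ℕtoℚ (suc m) * ℕtoℚ (suc m) + sum₂ f)
      ≤ ℕtoℚ (suc m) * sum₂ f + ℕtoℚ (suc m)
    sum-residuals = subst₂ _≤_ lhs rhs (sum₂-mono pointwise)
      where
      N = ℕtoℚ (suc m)
      -- The constant is written `1ℚ * 1ℚ` so that `sum₂-product` evaluates its double sum to N².
      -- The term `δ a b * 1ℚ` compensates for it on the diagonal, where nothing is lost.
      pointwise : ∀ a b → sum (λ w → R w a b) + (1ℚ * 1ℚ + f a b) ≤ N * f a b + δ a b * 1ℚ
      pointwise a b = δ-elim
        (λ e → sum (λ w → R w a b) + (1ℚ * 1ℚ + f a b) ≤ N * f a b + e * 1ℚ) a b
        (λ { refl → ℚ.≤-reflexive (cong₂ _+_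
          (trans (sum-zero (λ w → residual-diag w a))
              (sym (trans (cong (N *_) (proximity-self G a)) (ℚ.*-zeroʳ N))))
          (cong (1ℚ +_) (proximity-self G a))) })
        (λ a≢b → subst (sum (λ w → R w a b) + (1ℚ + f a b) ≤_) (sym (ℚ.+-identityʳ (N * f a b)))
            (sum-residual-pair a≢b))
      lhs = trans (sum₂-+ (λ a b → sum (λ w → R w a b)) (λ a b → 1ℚ * 1ℚ + f a b))
              (cong₂ _+_ (trans (sum-cong-≗ (λ a → ∑-comm (λ b w → R w a b)))
                  (∑-comm (λ a w → sum (R w a))))
                (trans (sum₂-+ {suc m} (λ _ _ → 1ℚ * 1ℚ) f)
                    (cong (_+ sum₂ f) (trans (sum₂-product {suc m} (λ _ → 1ℚ) (λ _ → 1ℚ))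
                    (cong₂ _*_ ones ones)))))
        where
        ones : sum {suc m} (λ _ → 1ℚ) ≡ N
        ones = trans (sum-const (suc m) 1ℚ) (ℚ.*-identityʳ N)
      rhs = trans (sum₂-+ (λ a b → N * f a b) (λ a b → δ a b * 1ℚ))
              (cong₂ _+_ (sum₂-scale N f) (trans (sum₂-δ {suc m} (λ _ → 1ℚ))
                  (trans (sum-const (suc m) 1ℚ) (ℚ.*-identityʳ N))))

    -- The component and the vertex through which it is entered

    module Component (v : Fin (suc m)) (c : Fin (suc m) → Bool)
      (c-Conn : ∀ {a b} → c a ≡ true → c b ≡ true → Conn G v a b)
      (c-closed : ∀ {a b} → c a ≡ true → Conn G v a b → c b ≡ true)
      (x : Fin (suc m)) (cx : c x ≡ true) where

      ∈-or-∉ : ∀ z → c z ≡ true ⊎ ¬ c z ≡ true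
      ∈-or-∉ z with c z
      ... | true  = inj₁ refl
      ... | false = inj₂ λ ()

      v∉ : ∀ {a} → c a ≡ true → v ≢ a
      v∉ ca = first (proj₂ (c-Conn ca ca))

      -- An outer endpoint other than `v` would be connected to `q` without `v`, hence belong to the
      -- component.
      boundary : ∀ {p q} → ¬ c p ≡ true → c q ≡ true → Adj G p q → p ≡ v
      boundary {p} p∉ q∈ e with v ≟ p
      ... | yes v≡p = sym v≡p
      ... | no v≢p  = contradiction (c-closed q∈ (Conn-Adj G (v∉ q∈) v≢p (Adj-sym G e))) p∉

      gateway : ∃ λ u → c u ≡ true × Adj G v u
      gateway with crossing G ∈-or-∉ (proj₂ (connected v x)) (λ cv → v∉ cv refl) cx
      ... | p , u , _ , p∉ , u∈ , e , _ = u , u∈ , subst (λ z → Adj G z u) (boundary p∉ u∈ e) e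

      u = proj₁ gateway
      u∈ = proj₁ (proj₂ gateway)

      -- A walk from outside enters along an edge from `v`. It must end at `u`, since a second
      -- neighbour of `v` in the component would be joined to `u` in the graph without `v`, giving a
      -- cycle.
      through-u : ∀ {P : Fin (suc m) → Set} {k a b} → ¬ c a ≡ true → c b ≡ true → Walk G P k a b →
        ∃ λ j → j ℕ.< k × Walk G P j u b
      through-u {P} {b = b} a∉ b∈ w with crossing G ∈-or-∉ w a∉ b∈
      ... | p , q , j , p∉ , q∈ , e , lt , w′ with boundary p∉ q∈ e | q ≟ u
      ... | _    | yes refl = j , lt , w′
      ... | refl | no q≢u   = contradiction (c-Conn q∈ u∈)
          (¬Conn-neighbours G acyclic e (proj₂ (proj₂ gateway)) q≢u)

      separated : ∀ {a b} → ¬ c a ≡ true → c b ≡ true → ¬ Conn G u a b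
      separated a∉ b∈ (_ , p) = first (proj₂ (proj₂ (through-u a∉ b∈ p))) refl

      -- Block-by-block estimates for deleting u and v

      χ̄ : Fin (suc m) → ℚ
      χ̄ a = χ (not (c a))

      -- `K` counts the vertices outside the component, `v` included. `Fᵤ`, `Fᵥ` and `F` are twice
      -- the `IGL` of the graph without `u`, without `v`, and in full.
      K S Fᵤ Fᵥ F : ℚ
      K  = sum χ̄
      S  = sum (λ b → χ (c b) * f u b)
      Fᵤ = sum₂ (R u)
      Fᵥ = sum₂ (R v)
      F  = sum₂ f

      -- Inside the component, deleting `v` loses nothing, whereas deleting `u` loses at least the
      -- row of `u`, whose sum is `S`. Mixed pairs have residual 0 for `u`. The pairs of distinct
      -- outer vertices contribute at most 1 each, K² - K in all.
      compare-u-v : Fᵤ + S + K ≤ Fᵥ + K * K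
      compare-u-v = subst₂ _≤_ lhs rhs (sum₂-mono pointwise)
        where
        pointwise : ∀ a b → R u a b + δ u a * (χ (c b) * f u b) + δ a b * χ̄ a
            ≤ R v a b + χ̄ a * χ̄ b
        pointwise a b with c a in ca | c b in cb
        ... | true | true = subst₂ _≤_
            (solve 4 (λ r d g e → r :+ d :* g := r :+ d :* (con 1ℚ :* g) :+ e :* con 0ℚ)
                refl (R u a b) (δ u a) (f u b) (δ a b))
            (trans (sym (Conn⇒residual (c-Conn ca cb))) (sym (ℚ.+-identityʳ (R v a b))))
            inside
          where
          inside : R u a b + δ u a * f u b ≤ f a b
          inside = δ-elim (λ d → R u a b + d * f u b ≤ f a b) u a
            (λ { refl → ℚ.≤-reflexive (trans (cong₂ _+_ (residual-selfˡ G u b)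
                (ℚ.*-identityˡ (f u b))) (ℚ.+-identityˡ (f u b))) })
            (λ _ → subst (_≤ f a b) (solve 2 (λ r g → r := r :+ con 0ℚ :* g)
                refl (R u a b) (f u b)) (residual≤proximity u a b))
        ... | true | false = subst₂ _≤_
            (trans (sym (¬Conn⇒residual (λ r → separated
                (λ cb′ → false≢true (trans (sym cb) cb′)) ca (Conn-sym G r))))
              (solve 4 (λ r d g e → r := r :+ d :* (con 0ℚ :* g) :+ e :* con 0ℚ)
                  refl (R u a b) (δ u a) (f u b) (δ a b)))
            (sym (ℚ.+-identityʳ (R v a b)))
            (residual-nonneg v a b)
        ... | false | true = subst₂ _≤_
            (trans (sym (¬Conn⇒residual (separated a∉ cb)))
              (trans (solve 2 (λ r g → r := r :+ con 0ℚ :* (con 1ℚ :* g) :+ con 0ℚ :* con 1ℚ)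
                  refl (R u a b) (f u b))
                (cong₂ (λ d e → R u a b + d * (1ℚ * f u b) + e * 1ℚ)
                  (sym (δ-≢ {i = u} {a} (λ { refl → a∉ u∈ })))
                      (sym (δ-≢ {i = a} {b} (λ { refl → a∉ cb }))))))
            (sym (ℚ.+-identityʳ (R v a b)))
            (residual-nonneg v a b)
          where
          a∉ : ¬ c a ≡ true
          a∉ ca′ = false≢true (trans (sym ca) ca′)
        ... | false | false = subst₂ _≤_
            (solve 4 (λ r d g e → r :+ e := r :+ d :* (con 0ℚ :* g) :+ e :* con 1ℚ)
                refl (R u a b) (δ u a) (f u b) (δ a b))
            refl
            outside
          where
          outside : R u a b + δ a b ≤ R v a b + 1ℚ
          outside = δ-elim (λ e → R u a b + e ≤ R v a b + 1ℚ) a b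
            (λ { refl → ℚ.≤-reflexive (cong (_+ 1ℚ)
                (trans (residual-diag u a) (sym (residual-diag v a)))) })
            (λ _ → subst₂ _≤_ (sym (ℚ.+-identityʳ (R u a b))) refl
                (ℚ.≤-trans (ℚ.≤-trans (residual≤proximity u a b) (invD≤1 (dist G a b)))
              (subst (_≤ R v a b + 1ℚ) (ℚ.+-identityˡ 1ℚ)
                  (ℚ.+-monoˡ-≤ 1ℚ (residual-nonneg v a b)))))
        lhs = trans (sum₂-+ (λ a b → R u a b + δ u a * (χ (c b) * f u b)) (λ a b → δ a b * χ̄ a))
                (cong₂ _+_ (trans (sum₂-+ (R u) (λ a b → δ u a * (χ (c b) * f u b)))
                  (cong (Fᵤ +_) (trans (sum₂-product (δ u) (λ b → χ (c b) * f u b))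
                      (trans (cong (_* S) (sum-δ-1 u)) (ℚ.*-identityˡ S)))))
                  (sum₂-δ χ̄))
        rhs = trans (sum₂-+ (R v) (λ a b → χ̄ a * χ̄ b)) (cong (Fᵥ +_) (sum₂-product χ̄ χ̄))

      -- Pairs inside the component lose nothing and pairs outside lose at most K² - K. A mixed pair
      -- is bounded by the proximity of its inner vertex to `u`, which gives K(S + 1) for each of
      -- the two orders.
      loss-at-v : F + K ≤ Fᵥ + K * K + K * (S + 1ℚ) + K * (S + 1ℚ)
      loss-at-v = subst₂ _≤_ lhs rhs (sum₂-mono pointwise)
        where
        h : Fin (suc m) → ℚ
        -- The summand `δ u b` covers `b ≡ u`, where the proximity to `u` is 0 by convention
        -- although an outer vertex may be at distance 1. It is the source of the 1 in S + 1.
        h b = χ (c b) * (f u b + δ u b)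
        across : ∀ {a b} → c a ≡ false → c b ≡ true → f a b ≤ f u b + δ u b
        across {a} {b} ca cb = δ-elim (λ e → f a b ≤ f u b + e) u b
          (λ { refl → ℚ.≤-trans (invD≤1 (dist G a u))
              (subst (_≤ f u u + 1ℚ) (ℚ.+-identityˡ 1ℚ)
              (ℚ.+-monoˡ-≤ 1ℚ (invD-nonneg (dist G u u)))) })
          (λ u≢b → subst (f a b ≤_) (sym (ℚ.+-identityʳ (f u b))) (proximity-mono G u≢b shorten))
          where
          shorten : ∀ {k} → AnyWalk G k a b → ∃ λ j → j ℕ.≤ k × AnyWalk G j u b
          shorten p with through-u (λ ca′ → false≢true (trans (sym ca) ca′)) cb p
          ... | j , lt , q = j , ℕ.<⇒≤ lt , q
        pointwise : ∀ a b → f a b + δ a b * χ̄ a ≤ R v a b + χ̄ a * χ̄ b + χ̄ a * h b + χ̄ b * h a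
        pointwise a b with c a in ca | c b in cb
        ... | true | true = ℚ.≤-reflexive (trans
            (cong (_+ δ a b * 0ℚ) (sym (Conn⇒residual (c-Conn ca cb))))
            (solve 4 (λ r e g g′ → r :+ e :* con 0ℚ
                := r :+ con 0ℚ :* con 0ℚ :+ con 0ℚ :* (con 1ℚ :* g) :+ con 0ℚ :* (con 1ℚ :* g′))
                refl (R v a b) (δ a b) (f u b + δ u b) (f u a + δ u a)))
        ... | true | false = subst₂ _≤_
            (solve 2 (λ g e → con 0ℚ :+ g := g :+ e :* con 0ℚ) refl (f a b) (δ a b))
            (solve 3 (λ r g g′ → r :+ g′
                := r :+ con 0ℚ :* con 1ℚ :+ con 0ℚ :* (con 0ℚ :* g) :+ con 1ℚ :* (con 1ℚ :* g′))
                refl (R v a b) (f u b + δ u b) (f u a + δ u a))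
            (ℚ.+-mono-≤ (residual-nonneg v a b)
                (subst (_≤ f u a + δ u a) (proximity-sym G b a) (across cb ca)))
        ... | false | true = subst₂ _≤_
            (trans (solve 1 (λ g → con 0ℚ :+ g := g :+ con 0ℚ :* con 1ℚ) refl (f a b))
              (cong (λ e → f a b + e * 1ℚ) (sym
                  (δ-≢ {i = a} {b} (λ { refl → false≢true (trans (sym ca) cb) })))))
            (solve 3 (λ r g g′ → r :+ g
                := r :+ con 1ℚ :* con 0ℚ :+ con 1ℚ :* (con 1ℚ :* g) :+ con 0ℚ :* (con 0ℚ :* g′))
                refl (R v a b) (f u b + δ u b) (f u a + δ u a))
            (ℚ.+-mono-≤ (residual-nonneg v a b) (across ca cb))
        ... | false | false = subst₂ _≤_
            (solve 2 (λ g e → con 0ℚ :+ (g :+ e) := g :+ e :* con 1ℚ) refl (f a b) (δ a b))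
            (solve 3 (λ r g g′ → r :+ con 1ℚ
                := r :+ con 1ℚ :* con 1ℚ :+ con 1ℚ :* (con 0ℚ :* g) :+ con 1ℚ :* (con 0ℚ :* g′))
                refl (R v a b) (f u b + δ u b) (f u a + δ u a))
            (ℚ.+-mono-≤ (residual-nonneg v a b) outside)
          where
          outside : f a b + δ a b ≤ 1ℚ
          outside = δ-elim (λ e → f a b + e ≤ 1ℚ) a b
            (λ { refl → ℚ.≤-reflexive (cong (_+ 1ℚ) (proximity-self G a)) })
            (λ _ → subst (_≤ 1ℚ) (sym (ℚ.+-identityʳ (f a b))) (invD≤1 (dist G a b)))
        sum-h : sum h ≡ S + 1ℚ
        sum-h = trans (sum-cong-≗ (λ b → trans (ℚ.*-distribˡ-+ (χ (c b)) (f u b) (δ u b))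
            (cong (χ (c b) * f u b +_) (ℚ.*-comm (χ (c b)) (δ u b)))))
          (trans (∑-distrib-+ (λ b → χ (c b) * f u b) (λ b → δ u b * χ (c b)))
              (cong (S +_) (trans (sum-δ u (λ b → χ (c b))) (cong χ u∈))))
        lhs = trans (sum₂-+ f (λ a b → δ a b * χ̄ a)) (cong (F +_) (sum₂-δ χ̄))
        rhs = trans (sum₂-+ (λ a b → R v a b + χ̄ a * χ̄ b + χ̄ a * h b) (λ a b → χ̄ b * h a))
          (cong₂ _+_ (trans (sum₂-+ (λ a b → R v a b + χ̄ a * χ̄ b) (λ a b → χ̄ a * h b))
            (cong₂ _+_ (trans (sum₂-+ (R v) (λ a b → χ̄ a * χ̄ b))
                (cong (Fᵥ +_) (sum₂-product χ̄ χ̄)))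
              (trans (sum₂-product χ̄ h) (cong (K *_) sum-h))))
            (trans (sum₂-productʳ χ̄ h) (cong (K *_) sum-h)))

-- Cardinalities and the bound on n in terms of r

χ-complement : ∀ b → χ (not b) + χ b ≡ 1ℚ
χ-complement true  = refl
χ-complement false = refl

sum-χ-lookup : (C : Subset n) → sum (λ i → χ (Vec.lookup C i)) ≡ ℕtoℚ ∣ C ∣
sum-χ-lookup []          = refl
sum-χ-lookup (true  ∷ C) = trans (cong (1ℚ +_) (sum-χ-lookup C)) (sym (ℕtoℚ-+ 1 ∣ C ∣))
sum-χ-lookup (false ∷ C) = trans (ℚ.+-identityˡ _) (sum-χ-lookup C)

-- K² − K + 2K(K² − K + 1) for K = r + 1.
sizeBound : ℕ → ℕ
sizeBound r = suc r ℕ.* r ℕ.+ (suc r ℕ.* (suc r ℕ.* r ℕ.+ 1) ℕ.+ suc r ℕ.* (suc r ℕ.* r ℕ.+ 1))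

-- Minimality turns the first comparison into S ≤ K² - K. Then the loss F - Fᵥ is at most
-- `sizeBound r`, while averaging bounds N times this loss below by N² - N + F.
order-bound : ∀ n r (K N S F Fᵤ Fᵥ : ℚ) → 3 ℕ.≤ n → K ≡ ℕtoℚ (suc r) → N ≡ ℕtoℚ n →
  0ℚ ≤ Fᵥ → 0ℚ ≤ F →
  Fᵥ ≤ Fᵤ →
  Fᵤ + S + K ≤ Fᵥ + K * K →
  F + K ≤ Fᵥ + K * K + K * (S + 1ℚ) + K * (S + 1ℚ) →
  N * Fᵥ + (N * N + F) ≤ N * F + N →
  n ℕ.≤ sizeBound r
-- If B < n, then n B + n ≤ n² ≤ n B + 1, which forces n ≤ 1.
order-bound n r K N S F Fᵤ Fᵥ 3≤n refl refl 0≤Fᵥ 0≤F Fᵥ≤Fᵤ h₁ h₂ h₃ = ℕ.≮⇒≥ λ B<n →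
  ℕ.<⇒≱ 3≤n (ℕ.≤-trans (ℕ.+-cancelˡ-≤ (n ℕ.* B) n 1
      (ℕ.≤-trans (ℕ.≤-reflexive (trans (ℕ.+-comm (n ℕ.* B) n) (sym (ℕ.*-suc n B))))
      (ℕ.≤-trans (ℕ.*-monoʳ-≤ n B<n) n²≤))) (s≤s z≤n))
  where
  B = sizeBound r
  ρ = ℕtoℚ r
  b = ℕtoℚ B
  instance
    K-nonneg : ℚ.NonNegative K
    K-nonneg = ℚ.nonNegative (ℕtoℚ-mono-≤ {0} {suc r} z≤n)
    N-nonneg : ℚ.NonNegative N
    N-nonneg = ℚ.nonNegative (ℕtoℚ-mono-≤ {0} {n} z≤n)
    N-pos : ℚ.Positive N
    N-pos = ℚ.positive (ℚ.<-≤-trans (from-yes (0ℚ ℚ.<? 1ℚ))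
        (ℕtoℚ-mono-≤ {1} {n} (ℕ.≤-trans (s≤s z≤n) 3≤n)))
  K≡ : K ≡ 1ℚ + ρ
  K≡ = ℕtoℚ-+ 1 r
  b≡ : b ≡ K * ρ + (K * (K * ρ + 1ℚ) + K * (K * ρ + 1ℚ))
  b≡ = trans (ℕtoℚ-+ a (t ℕ.+ t)) (cong₂ _+_ Kρ (trans (ℕtoℚ-+ t t) (cong (λ z → z + z) Kt)))
    where
    a = suc r ℕ.* r
    t = suc r ℕ.* (a ℕ.+ 1)
    Kρ : ℕtoℚ a ≡ K * ρ
    Kρ = ℕtoℚ-* (suc r) r
    Kt : ℕtoℚ t ≡ K * (K * ρ + 1ℚ)
    Kt = trans (ℕtoℚ-* (suc r) (a ℕ.+ 1)) (cong (K *_) (trans (ℕtoℚ-+ a 1) (cong (_+ 1ℚ) Kρ)))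
  S≤ : S ≤ K * ρ
  S≤ = ≤-shift (ℚ.+-mono-≤ h₁ Fᵥ≤Fᵤ) (trans
    (cong (λ z → S + (Fᵥ + K * z + Fᵤ)) K≡)
    (solve 5 (λ s fv k p fu → s :+ (fv :+ k :* (con 1ℚ :+ p) :+ fu)
        := k :* p :+ (fu :+ s :+ k :+ fv)) refl S Fᵥ K ρ Fᵤ))
  F≤ : F ≤ Fᵥ + b
  F≤ = ≤-shift (ℚ.+-mono-≤ h₂ (ℚ.+-mono-≤ KS≤ KS≤)) (trans
    (cong (λ z → F + (Fᵥ + K * z + K * (S + 1ℚ) + K * (S + 1ℚ)
      + (K * (K * ρ + 1ℚ) + K * (K * ρ + 1ℚ)))) K≡)
    (trans (solve 6 (λ f fv k p x y → f :+ (fv :+ k :* (con 1ℚ :+ p) :+ x :+ x :+ (y :+ y))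
        := fv :+ (k :* p :+ (y :+ y)) :+ (f :+ k :+ (x :+ x)))
        refl F Fᵥ K ρ (K * (S + 1ℚ)) (K * (K * ρ + 1ℚ)))
      (cong (λ z → Fᵥ + z + (F + K + (K * (S + 1ℚ) + K * (S + 1ℚ)))) (sym b≡))))
    where
    KS≤ : K * (S + 1ℚ) ≤ K * (K * ρ + 1ℚ)
    KS≤ = ℚ.*-monoˡ-≤-nonNeg K (ℚ.+-monoˡ-≤ 1ℚ S≤)
  NNF≤ : N * N + F ≤ N * b + N
  NNF≤ = ≤-shift (ℚ.+-mono-≤ h₃ (ℚ.*-monoˡ-≤-nonNeg N F≤))
    (solve 4 (λ m f fv p → m :* m :+ f :+ (m :* f :+ m :+ m :* (fv :+ p))
        := m :* p :+ m :+ (m :* fv :+ (m :* m :+ f) :+ m :* f)) refl N F Fᵥ b)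
  -- This absorbs the surplus N in `NNF≤` into F, leaving only an error of 1. It comes from the
  -- averaging inequality with the nonnegative terms Fᵥ and F dropped on its left.
  N≤ : N ≤ F + 1ℚ
  N≤ = ℚ.*-cancelˡ-≤-pos N (≤-shift (ℚ.+-mono-≤ h₃ (ℚ.+-mono-≤ 0≤F (ℚ.*-monoˡ-≤-nonNeg N 0≤Fᵥ)))
    (solve 3 (λ m f fv → m :* m :+ (m :* f :+ m :+ (f :+ m :* fv))
        := m :* (f :+ con 1ℚ) :+ (m :* fv :+ (m :* m :+ f) :+ (con 0ℚ :+ m :* con 0ℚ))) refl N F Fᵥ))
  NN≤ : N * N ≤ N * b + 1ℚ
  NN≤ = ≤-shift (ℚ.+-mono-≤ NNF≤ N≤)
    (solve 3 (λ m f p → m :* m :+ (m :* p :+ m :+ (f :+ con 1ℚ))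
        := m :* p :+ con 1ℚ :+ (m :* m :+ f :+ m)) refl N F b)
  n²≤ : n ℕ.* n ℕ.≤ n ℕ.* B ℕ.+ 1
  n²≤ = ℕtoℚ-cancel-≤ (subst₂ _≤_ (sym (ℕtoℚ-* n n))
      (sym (trans (ℕtoℚ-+ (n ℕ.* B) 1) (cong (_+ 1ℚ) (ℕtoℚ-* n B)))) NN≤)

-- For r = 0 the bound is 2, against n ≥ 3. For r ≥ 1 the cubic lies below 16 r⁴; at r = 1 the
-- values are 14 and 16.
sizeBound-quartic : ∀ {n} r → 3 ℕ.≤ n → n ℕ.≤ sizeBound r → n ℕ.≤ 16 ℕ.* (r ℕ.* r ℕ.* r ℕ.* r)
sizeBound-quartic zero    3≤n n≤ = contradiction (ℕ.≤-trans 3≤n n≤) λ { (s≤s (s≤s ())) }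
sizeBound-quartic (suc s) _   n≤ = ℕ.≤-trans n≤
  (ℕ.≤-trans (ℕ.m≤m+n (sizeBound (suc s)) gap) (ℕ.≤-reflexive expand))
  where
  module N = ℕ-Solver
  open N using () renaming (_:+_ to _⊕_; _:*_ to _⊗_)
  -- The difference of the two sides, expanded in s = r - 1, has only nonnegative coefficients.
  gap = 16 ℕ.* (s ℕ.* s ℕ.* s ℕ.* s) ℕ.+ 62 ℕ.* (s ℕ.* s ℕ.* s)
    ℕ.+ 85 ℕ.* (s ℕ.* s) ℕ.+ 43 ℕ.* s ℕ.+ 2
  expand : sizeBound (suc s) ℕ.+ gap ≡ 16 ℕ.* (suc s ℕ.* suc s ℕ.* suc s ℕ.* suc s)
  expand = N.solve 1 (λ s →
    let r = N.con 1 ⊕ s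
        q = N.con 1 ⊕ r
        w = q ⊗ (q ⊗ r ⊕ N.con 1)
    in (q ⊗ r ⊕ (w ⊕ w))
         ⊕ (N.con 16 ⊗ (s ⊗ s ⊗ s ⊗ s) ⊕ N.con 62 ⊗ (s ⊗ s ⊗ s)
             ⊕ N.con 85 ⊗ (s ⊗ s) ⊕ N.con 43 ⊗ s ⊕ N.con 2)
       N.:= N.con 16 ⊗ (r ⊗ r ⊗ r ⊗ r)) refl s

pow4-bound : ∀ n r → n ℕ.≤ 16 ℕ.* (r ℕ.* r ℕ.* r ℕ.* r) → pow4 ℚ.½ * ℕtoℚ n ≤ pow4 (ℕtoℚ r)
pow4-bound n r le = begin
  pow4 ℚ.½ * ℕtoℚ n
    ≤⟨ ℚ.*-monoˡ-≤-nonNeg (pow4 ℚ.½) (ℕtoℚ-mono-≤ le) ⟩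
  pow4 ℚ.½ * ℕtoℚ (16 ℕ.* (r ℕ.* r ℕ.* r ℕ.* r))
    ≡⟨ cong (pow4 ℚ.½ *_) (ℕtoℚ-* 16 (r ℕ.* r ℕ.* r ℕ.* r)) ⟩
  pow4 ℚ.½ * (ℕtoℚ 16 * ℕtoℚ (r ℕ.* r ℕ.* r ℕ.* r))
    ≡⟨ ℚ.*-assoc (pow4 ℚ.½) (ℕtoℚ 16) (ℕtoℚ (r ℕ.* r ℕ.* r ℕ.* r)) ⟨
  -- `pow4 ℚ.½ * ℕtoℚ 16` computes to 1.
  1ℚ * ℕtoℚ (r ℕ.* r ℕ.* r ℕ.* r)                 ≡⟨ ℚ.*-identityˡ (ℕtoℚ (r ℕ.* r ℕ.* r ℕ.* r)) ⟩
  ℕtoℚ (r ℕ.* r ℕ.* r ℕ.* r)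
    ≡⟨ trans (ℕtoℚ-* (r ℕ.* r ℕ.* r) r) (cong (_* ℕtoℚ r)
        (trans (ℕtoℚ-* (r ℕ.* r) r) (cong (_* ℕtoℚ r) (ℕtoℚ-* r r)))) ⟩
  pow4 (ℕtoℚ r)                                   ∎
  where open ℚ.≤-Reasoning

-- The given component as a set of vertices of the whole tree

module _ {m : ℕ} (T : Graph (suc m)) (v : Fin (suc m)) (x : Fin m) (C : Subset m)
  (C-spec : ∀ w → (w ∈ C) ⇔ Reachable (T -ᵛ v) x w) where

  -- `C` is indexed by the vertices of `T -ᵛ v`. Inserting `false` at position `v` transports it to
  -- `T`, with `v` outside.
  inC : Fin (suc m) → Bool
  inC = insertAt (Vec.lookup C) v false

  inC⇒Conn : ∀ {a} → inC a ≡ true → Conn T v (punchIn v x) a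
  inC⇒Conn {a} a∈ with v ≟ a
  ... | yes refl with trans (sym (insertAt-lookup (Vec.lookup C) v false)) a∈
  ... | ()
  inC⇒Conn {a} a∈ | no p with Equivalence.to (C-spec (punchOut p)) (lookup⇒[]= (punchOut p) C
    (trans (sym (insertAt-punchIn (Vec.lookup C) v false (punchOut p)))
        (trans (cong inC (punchIn-punchOut p)) a∈)))
  ... | k , walk = k , subst (Walk T (v ≢_) k (punchIn v x)) (punchIn-punchOut p)
      (lift T v (walkB⇒Walk (T -ᵛ v) k x (punchOut p) walk))

  Conn⇒inC : ∀ {a} → Conn T v (punchIn v x) a → inC a ≡ true
  Conn⇒inC {a} (k , w) = trans (cong inC (sym (punchIn-punchOut q)))
      (trans (insertAt-punchIn (Vec.lookup C) v false (punchOut q))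
    ([]=⇒lookup (Equivalence.from (C-spec (punchOut q)) (k , Walk⇒walkB
      (subst (λ i → AnyWalk (T -ᵛ v) k i (punchOut q))
          (trans (punchOut-cong v refl) (punchOut-punchIn v)) (lower T v (first w) q w))))))
    where
    q = last w

  sum-inC : sum (λ a → χ (inC a)) ≡ ℕtoℚ ∣ C ∣
  sum-inC = begin
    sum (λ a → χ (inC a))                                  ≡⟨ sum-remove {i = v} (λ a → χ (inC a)) ⟩
    χ (inC v) + sum (λ i → χ (inC (punchIn v i)))
      ≡⟨ cong₂ _+_ (cong χ (insertAt-lookup (Vec.lookup C) v false))
          (sum-cong-≗ (λ i → cong χ (insertAt-punchIn (Vec.lookup C) v false i))) ⟩
    0ℚ + sum (λ i → χ (Vec.lookup C i))                    ≡⟨ ℚ.+-identityˡ _ ⟩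
    sum (λ i → χ (Vec.lookup C i))                         ≡⟨ sum-χ-lookup C ⟩
    ℕtoℚ ∣ C ∣                                             ∎
    where open ≡-Reasoning

  sum-outside : sum (λ a → χ (not (inC a))) ≡ ℕtoℚ (suc (suc m ∸ ∣ C ∣ ∸ 1))
  sum-outside = trans (sym (+-cancel-neg _ (ℕtoℚ ∣ C ∣)))
    (trans (cong (_+ ℚ.- ℕtoℚ ∣ C ∣) total) (+-cancel-neg _ (ℕtoℚ ∣ C ∣)))
    where
    -- Since `C` has at most m elements, neither truncated subtraction cuts off. The outer `suc`
    -- accounts for `v`.
    split : suc (suc m ∸ ∣ C ∣ ∸ 1) ℕ.+ ∣ C ∣ ≡ suc m
    split rewrite ℕ.+-∸-assoc 1 (∣p∣≤n C) = cong suc (ℕ.m∸n+n≡m (∣p∣≤n C))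
    total : sum (λ a → χ (not (inC a))) + ℕtoℚ ∣ C ∣ ≡ ℕtoℚ (suc (suc m ∸ ∣ C ∣ ∸ 1)) + ℕtoℚ ∣ C ∣
    total = begin
      sum (λ a → χ (not (inC a))) + ℕtoℚ ∣ C ∣
        ≡⟨ cong (sum (λ a → χ (not (inC a))) +_) sum-inC ⟨
      sum (λ a → χ (not (inC a))) + sum (λ a → χ (inC a))
        ≡⟨ ∑-distrib-+ (λ a → χ (not (inC a))) (λ a → χ (inC a)) ⟨
      sum (λ a → χ (not (inC a)) + χ (inC a))
        ≡⟨ sum-cong-≗ (λ a → χ-complement (inC a)) ⟩
      sum {suc m} (λ _ → 1ℚ)
        ≡⟨ trans (sum-const (suc m) 1ℚ) (ℚ.*-identityʳ (ℕtoℚ (suc m))) ⟩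
      ℕtoℚ (suc m)                                              ≡⟨ cong ℕtoℚ split ⟨
      ℕtoℚ (suc (suc m ∸ ∣ C ∣ ∸ 1) ℕ.+ ∣ C ∣)
        ≡⟨ ℕtoℚ-+ (suc (suc m ∸ ∣ C ∣ ∸ 1)) ∣ C ∣ ⟩
      ℕtoℚ (suc (suc m ∸ ∣ C ∣ ∸ 1)) + ℕtoℚ ∣ C ∣               ∎
      where open ≡-Reasoning

theorem18 : Σ ℚ λ c → (0ℚ < c) × (c < 1ℚ) ×
    ((m : ℕ) (T : Graph (suc m)) → 3 Data.Nat.≤ suc m → IsTree T →
    (v : Fin (suc m)) → (∀ w → IGL (T -ᵛ v) ≤ IGL (T -ᵛ w)) →
    (x : Fin m) (C : Subset m) → (∀ w → (w ∈ C) ⇔ Reachable (T -ᵛ v) x w) →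
    pow4 c * ℕtoℚ (suc m) ≤ pow4 (ℕtoℚ (suc m ∸ ∣ C ∣ ∸ 1)))
-- The constant 1/2 is the fourth root of 1/16, matching the factor 16 in `sizeBound-quartic`.
theorem18 = ℚ.½ , from-yes (0ℚ ℚ.<? ℚ.½) , from-yes (ℚ.½ ℚ.<? 1ℚ) , bound
  where
  bound : (m : ℕ) (T : Graph (suc m)) → 3 Data.Nat.≤ suc m → IsTree T →
    (v : Fin (suc m)) → (∀ w → IGL (T -ᵛ v) ≤ IGL (T -ᵛ w)) →
    (x : Fin m) (C : Subset m) → (∀ w → (w ∈ C) ⇔ Reachable (T -ᵛ v) x w) →
    pow4 ℚ.½ * ℕtoℚ (suc m) ≤ pow4 (ℕtoℚ (suc m ∸ ∣ C ∣ ∸ 1))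
  bound m T 3≤n (connected , acyclic) v minimal x C C-spec =
    pow4-bound (suc m) r (sizeBound-quartic r 3≤n
      (order-bound (suc m) r K N S F Fᵤ Fᵥ 3≤n (sum-outside T v x C C-spec) refl
        (sum₂-nonneg (residual-nonneg T acyclic v))
            (sum₂-nonneg (λ a b → invD-nonneg (dist T a b)))
            (least u) compare-u-v loss-at-v average))
    where
    r = suc m ∸ ∣ C ∣ ∸ 1
    N = ℕtoℚ (suc m)
    walks : ∀ a b → ∃ λ k → AnyWalk T k a b
    walks a b with connected a b
    ... | k , eq = k , walkB⇒Walk T k a b eq
    open Component T acyclic walks v (inC T v x C C-spec)
      (λ a∈ b∈ → Conn-trans T (Conn-sym T (inC⇒Conn T v x C C-spec a∈))
          (inC⇒Conn T v x C C-spec b∈))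
      (λ a∈ c → Conn⇒inC T v x C C-spec (Conn-trans T (inC⇒Conn T v x C C-spec a∈) c))
      (punchIn v x)
      (Conn⇒inC T v x C C-spec (0 , stop (≢-sym (punchInᵢ≢i v x))))
    least : ∀ w → Fᵥ ≤ sum₂ (residual T w)
    least w = subst₂ _≤_ (sym (sum-residual T v)) (sym (sum-residual T w))
        (ℚ.+-mono-≤ (minimal w) (minimal w))
    -- The minimum is at most the average: N copies of Fᵥ are bounded by the sum of the residual
    -- totals over all deleted vertices.
    average : N * Fᵥ + (N * N + F) ≤ N * F + N
    average = ℚ.≤-trans (ℚ.+-monoˡ-≤ (N * N + F)
        (subst (_≤ sum (λ w → sum₂ (residual T w))) (sum-const (suc m) Fᵥ) (sum-mono least)))
      (sum-residuals T acyclic walks)
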